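{- Let $n\in\mathbb{N}$, $q\ge 2$, and let $\Gamma$ be a finite constraint language of $k$-ary relations over $[q]$. For $a,b\in[q]^n$, define $(a,b)\in\mathcal{E}$ if every instance of $\mathsf{CSP}(\Gamma)$ on $n$ variables that is satisfied by $a$ is also satisfied by $b$. Then $\mathcal{E}$ is an equivalence relation on $[q]^n$. Moreover, for every $a\in[q]^n$ there exists an instance $P_a$ of $\mathsf{CSP}(\Gamma)$ on $n$ variables with $\mathrm{Sat}(P_a)=[a]_{\mathcal{E}}$, the equivalence class of $a$ under $\mathcal{E}$.
   Context: An instance of $\mathsf{CSP}(\Gamma)$ on variables $x_1,\dots,x_n$ over $[q]=\{0,\dots,q-1\}$ is a finite set of constraints $\{R,(x_{i_1}+\lambda_{i_1},\dots,x_{i_k}+\lambda_{i_k})\}$ with $R\in\Gamma$, $(i_1,\dots,i_k)\in[n]^k$, $\lambda_{i_j}\in[q]$; an assignment $a\in[q]^n$ satisfies it if $(a_{i_1}+\lambda_{i_1},\dots,a_{i_k}+\lambda_{i_k})\in R$ (addition mod $q$), and satisfies the instance if it satisfies all its constraints. $\mathrm{Sat}(I)$ denotes the set of assignments satisfying $I$. -}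

module Defs where

open import Data.Bool.Base using (Bool; T)
open import Data.Fin.Base using (Fin; toℕ)
open import Data.List.Base using (List)
open import Data.List.Membership.Propositional using (_∈_)
open import Data.List.Relation.Unary.All using (All)
open import Data.Nat.Base as ℕ using (ℕ; zero; suc)
open import Data.Nat.DivMod using (_mod_)
open import Data.Vec.Base using (Vec; lookup; zipWith)
open import Level using (0ℓ)
open import Relation.Binary.Core using (Rel)
open import Relation.Unary using (Pred)

infixl 6 _⊕_

-- Addition modulo q.
_⊕_ : ∀ {q} → Fin q → Fin q → Fin q
_⊕_ {zero}  ()
_⊕_ {suc q} x y = (toℕ x ℕ.+ toℕ y) mod suc q

-- A subset of [q]^k, given by its characteristic function.
Relation : (q k : ℕ) → Set
Relation q k = Vec (Fin q) k → Bool

-- Order and repetitions in the list have no effect on which constraints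
-- can be formed; the list only expresses finiteness.
Language : (q k : ℕ) → Set
Language q k = List (Relation q k)

Assignment : (q n : ℕ) → Set
Assignment q n = Vec (Fin q) n

-- The constraint (R , (x_{i₁} + λ₁ , … , x_{i_k} + λ_k)).  Variables may be
-- repeated, and each position carries its own shift.
record Constraint {q k : ℕ} (n : ℕ) (Γ : Language q k) : Set where
  field
    relation   : Relation q k
    relation∈Γ : relation ∈ Γ
    variables  : Vec (Fin n) k
    shifts     : Vec (Fin q) k

-- A finite set of constraints, as a list: satisfaction does not depend on
-- order or repetitions.
Instance : {q k : ℕ} (n : ℕ) → Language q k → Set
Instance n Γ = List (Constraint n Γ)

module _ {q k n : ℕ} {Γ : Language q k} where

  SatisfiesConstraint : Assignment q n → Constraint n Γ → Set
  SatisfiesConstraint a C =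
    T (relation (zipWith (λ i s → lookup a i ⊕ s) variables shifts))
    where open Constraint C

  Satisfies : Assignment q n → Instance n Γ → Set
  Satisfies a I = All (SatisfiesConstraint a) I

  Sat : Instance n Γ → Pred (Assignment q n) 0ℓ
  Sat I a = Satisfies a I

ℰ : {q k : ℕ} (n : ℕ) (Γ : Language q k) → Rel (Assignment q n) 0ℓ
ℰ n Γ a b = (I : Instance n Γ) → Satisfies a I → Satisfies b I

Class : {A : Set} → Rel A 0ℓ → A → Pred A 0ℓ
Class _∼_ a b = a ∼ b

{-# OPTIONS --safe #-}
-- ℰ is reflexive and transitive by construction; symmetry comes from the
-- shifts.  Let (a , b) ∈ ℰ, let b satisfy C, and translate C by b − a, that is,
-- add bᵢ − aᵢ to the shift at each occurrence of xᵢ.  Then a satisfies the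
-- translate of C, hence so does b, and the step can be repeated: a satisfies all
-- the iterated translates of C.  The q-th one is C itself, because q (b − a) = 0.
-- There are finitely many constraints, so P_a may consist of all those that a
-- satisfies.
module Submission where

open import Defs
open import Data.Bool.Base using (T)
open import Data.Bool.Properties using (T?)
open import Data.Fin.Base using (Fin; toℕ)
open import Data.Fin.Properties using (toℕ-fromℕ<; toℕ-injective; toℕ<n; toℕ≤n)
open import Data.List.Base as List using (List; allFin; cartesianProduct; cartesianProductWith; filter)
open import Data.List.Membership.Propositional using (_∈_; mapWith∈)
open import Data.List.Membership.Propositional.Properties
  using (∈-allFin; ∈-cartesianProduct⁺; ∈-cartesianProductWith⁺; ∈-filter⁺)
open import Data.List.Relation.Unary.All as All using ()
open import Data.List.Relation.Unary.All.Properties using (all-filter)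
open import Data.List.Relation.Unary.Any using (here)
open import Data.List.Relation.Unary.Any.Properties using (mapWith∈⁺)
open import Data.Nat.Base using (ℕ; zero; suc; _≤_; _+_; _*_; _∸_; _%_; NonZero; s≤s)
open import Data.Nat.DivMod
  using (_mod_; m%n<n; m%n%n≡m%n; %-distribˡ-+; [m+n]%n≡m%n; [m+kn]%n≡m%n; m<n⇒m%n≡m)
open import Data.Nat.GeneralisedArithmetic using (fold)
open import Data.Nat.Properties using (+-assoc; +-comm; *-comm; m+[n∸m]≡n)
open import Data.Product.Base using (_×_; Σ-syntax; _,_)
open import Data.Vec.Base using (Vec; []; _∷_; lookup; zipWith)
open import Function.Base using (id; _∘_)
open import Relation.Binary.PropositionalEquality
  using (_≡_; refl; sym; trans; cong; cong₂; subst; module ≡-Reasoning)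
open import Relation.Binary.Structures using (IsEquivalence)
open import Relation.Nullary.Decidable.Core using (Dec)
open import Relation.Unary using (_≐_)

open ≡-Reasoning

-- Arithmetic modulo q.

[m+n%d]%d≡[m+n]%d : ∀ m n d .{{_ : NonZero d}} → (m + n % d) % d ≡ (m + n) % d
[m+n%d]%d≡[m+n]%d m n d = begin
  (m + n % d) % d          ≡⟨ %-distribˡ-+ m (n % d) d ⟩
  (m % d + n % d % d) % d  ≡⟨ cong (λ r → (m % d + r) % d) (m%n%n≡m%n n d) ⟩
  (m % d + n % d) % d      ≡⟨ %-distribˡ-+ m n d ⟨
  (m + n) % d              ∎

module _ {p : ℕ} where

  private
    q = suc p

  toℕ-mod : ∀ m → toℕ (m mod q) ≡ m % q
  toℕ-mod m = toℕ-fromℕ< (m%n<n m q)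

  toℕ-%-identity : (x : Fin q) → toℕ x % q ≡ toℕ x
  toℕ-%-identity x = m<n⇒m%n≡m (toℕ<n x)

  toℕ-⊕ : (x y : Fin q) → toℕ (x ⊕ y) ≡ (toℕ x + toℕ y) % q
  toℕ-⊕ x y = toℕ-mod (toℕ x + toℕ y)

  ⊕-comm : (x y : Fin q) → x ⊕ y ≡ y ⊕ x
  ⊕-comm x y = cong (_mod q) (+-comm (toℕ x) (toℕ y))

  toℕ-⊕-⊕ : (x y z : Fin q) → toℕ (x ⊕ (y ⊕ z)) ≡ (toℕ x + (toℕ y + toℕ z)) % q
  toℕ-⊕-⊕ x y z = begin
    toℕ (x ⊕ (y ⊕ z))                    ≡⟨ toℕ-⊕ x (y ⊕ z) ⟩
    (toℕ x + toℕ (y ⊕ z)) % q            ≡⟨ cong (λ r → (toℕ x + r) % q) (toℕ-⊕ y z) ⟩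
    (toℕ x + (toℕ y + toℕ z) % q) % q    ≡⟨ [m+n%d]%d≡[m+n]%d (toℕ x) _ q ⟩
    (toℕ x + (toℕ y + toℕ z)) % q        ∎

  ⊕-assoc : (x y z : Fin q) → (x ⊕ y) ⊕ z ≡ x ⊕ (y ⊕ z)
  ⊕-assoc x y z = toℕ-injective (begin
    -- Commutativity turns the left-nested sum into a right-nested one, so `toℕ-⊕-⊕` serves both
    -- sides.
    toℕ ((x ⊕ y) ⊕ z)              ≡⟨ cong toℕ (⊕-comm (x ⊕ y) z) ⟩
    toℕ (z ⊕ (x ⊕ y))              ≡⟨ toℕ-⊕-⊕ z x y ⟩
    (toℕ z + (toℕ x + toℕ y)) % q  ≡⟨ cong (_% q) (+-comm (toℕ z) _) ⟩
    (toℕ x + toℕ y + toℕ z) % q    ≡⟨ cong (_% q) (+-assoc (toℕ x) _ _) ⟩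
    (toℕ x + (toℕ y + toℕ z)) % q  ≡⟨ toℕ-⊕-⊕ x y z ⟨
    toℕ (x ⊕ (y ⊕ z))              ∎)

  infixl 6 _⊖_

  -- Since `toℕ x ≤ q`, taking `x` from `q` before adding `y` keeps the truncated subtraction exact.
  _⊖_ : Fin q → Fin q → Fin q
  y ⊖ x = (q ∸ toℕ x + toℕ y) mod q

  x⊕[y⊖x]≡y : (x y : Fin q) → x ⊕ (y ⊖ x) ≡ y
  x⊕[y⊖x]≡y x y = toℕ-injective (begin
    toℕ (x ⊕ (y ⊖ x))                      ≡⟨ toℕ-⊕ x (y ⊖ x) ⟩
    (toℕ x + toℕ (y ⊖ x)) % q              ≡⟨ cong (λ r → (toℕ x + r) % q) (toℕ-mod (q ∸ toℕ x + toℕ y)) ⟩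
    (toℕ x + (q ∸ toℕ x + toℕ y) % q) % q  ≡⟨ [m+n%d]%d≡[m+n]%d (toℕ x) _ q ⟩
    (toℕ x + (q ∸ toℕ x + toℕ y)) % q      ≡⟨ cong (_% q) (+-assoc (toℕ x) _ _) ⟨
    (toℕ x + (q ∸ toℕ x) + toℕ y) % q      ≡⟨ cong (λ r → (r + toℕ y) % q) (m+[n∸m]≡n (toℕ≤n x)) ⟩
    (q + toℕ y) % q                        ≡⟨ cong (_% q) (+-comm q _) ⟩
    (toℕ y + q) % q                        ≡⟨ [m+n]%n≡m%n (toℕ y) q ⟩
    toℕ y % q                              ≡⟨ toℕ-%-identity y ⟩
    toℕ y                                  ∎)

  toℕ-fold-⊕ : (s d : Fin q) (m : ℕ) → toℕ (fold s (d ⊕_) m) ≡ (m * toℕ d + toℕ s) % q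
  -- The right side is reduced even when nothing has been added, so this case rests on `toℕ s < q`.
  toℕ-fold-⊕ s d zero    = sym (toℕ-%-identity s)
  toℕ-fold-⊕ s d (suc m) = begin
    toℕ (d ⊕ fold s (d ⊕_) m)                ≡⟨ toℕ-⊕ d _ ⟩
    (toℕ d + toℕ (fold s (d ⊕_) m)) % q      ≡⟨ cong (λ r → (toℕ d + r) % q) (toℕ-fold-⊕ s d m) ⟩
    (toℕ d + (m * toℕ d + toℕ s) % q) % q    ≡⟨ [m+n%d]%d≡[m+n]%d (toℕ d) _ q ⟩
    (toℕ d + (m * toℕ d + toℕ s)) % q        ≡⟨ cong (_% q) (+-assoc (toℕ d) _ _) ⟨
    (suc m * toℕ d + toℕ s) % q              ∎

  fold-⊕-period : (s d : Fin q) → fold s (d ⊕_) q ≡ s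
  fold-⊕-period s d = toℕ-injective (begin
    toℕ (fold s (d ⊕_) q)      ≡⟨ toℕ-fold-⊕ s d q ⟩
    (q * toℕ d + toℕ s) % q    ≡⟨ cong (_% q) (+-comm (q * toℕ d) _) ⟩
    (toℕ s + q * toℕ d) % q    ≡⟨ cong (λ r → (toℕ s + r) % q) (*-comm q (toℕ d)) ⟩
    (toℕ s + toℕ d * q) % q    ≡⟨ [m+kn]%n≡m%n (toℕ s) (toℕ d) q ⟩
    toℕ s % q                  ≡⟨ toℕ-%-identity s ⟩
    toℕ s                      ∎)

-- Iterated coordinatewise maps on vectors.

module _ {A B : Set} where

  -- Translating a constraint and evaluating it both run over the same vector of variables; fusing
  -- the two passes leaves one identity per position.
  zipWith-fuse : ∀ {C D : Set} {f : A → C → D} {g : A → B → C} {h : A → B → D} {k} →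
    (∀ x y → f x (g x y) ≡ h x y) → (xs : Vec A k) (ys : Vec B k) →
    zipWith f xs (zipWith g xs ys) ≡ zipWith h xs ys
  zipWith-fuse eq []       []       = refl
  zipWith-fuse eq (x ∷ xs) (y ∷ ys) = cong₂ _∷_ (eq x y) (zipWith-fuse eq xs ys)

  module _ (f : A → B → B) where

    fold-zipWith-[] : ∀ m → fold [] (zipWith f []) m ≡ []
    fold-zipWith-[] zero    = refl
    fold-zipWith-[] (suc m) = cong (zipWith f []) (fold-zipWith-[] m)

    fold-zipWith-∷ : ∀ {k} x (xs : Vec A k) y ys m →
      fold (y ∷ ys) (zipWith f (x ∷ xs)) m ≡ fold y (f x) m ∷ fold ys (zipWith f xs) m
    fold-zipWith-∷ x xs y ys zero    = refl
    fold-zipWith-∷ x xs y ys (suc m) = cong (zipWith f (x ∷ xs)) (fold-zipWith-∷ x xs y ys m)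

    -- Each coordinate evolves on its own, by a map that depends on its entry of `xs`; a period
    -- common to all these maps is a period of the whole vector.
    fold-zipWith-period : ∀ {k} m → (∀ x y → fold y (f x) m ≡ y) →
      (xs : Vec A k) (ys : Vec B k) → fold ys (zipWith f xs) m ≡ ys
    fold-zipWith-period m eq []       []       = fold-zipWith-[] m
    fold-zipWith-period m eq (x ∷ xs) (y ∷ ys) =
      trans (fold-zipWith-∷ x xs y ys m) (cong₂ _∷_ (eq x y) (fold-zipWith-period m eq xs ys))

-- Symmetry by translating shifts.

module _ {q k n : ℕ} {Γ : Language q k} where

  satisfiesConstraint? : (a : Assignment q n) (C : Constraint n Γ) → Dec (SatisfiesConstraint a C)
  satisfiesConstraint? a C = T? _

  ℰ⇒constraint : ∀ a b → ℰ n Γ a b → (C : Constraint n Γ) →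
    SatisfiesConstraint a C → SatisfiesConstraint b C
  ℰ⇒constraint a b ab C aC = All.head (ab List.[ C ] (aC All.∷ All.[]))

  withShifts : Constraint n Γ → Vec (Fin q) k → Constraint n Γ
  withShifts C ss = record C { shifts = ss }

module _ {p k n : ℕ} {Γ : Language (suc p) k} where

  ℰ-sym : ∀ a b → ℰ n Γ a b → ℰ n Γ b a
  ℰ-sym a b ab I = All.map λ {C} → fromTranslates C
    where
    d : Fin n → Fin (suc p)
    -- The displacement belongs to the variable, so all occurrences of a repeated variable move
    -- alike.
    d i = lookup b i ⊖ lookup a i

    module _ (C : Constraint n Γ) where
      open Constraint C

      translate : Vec (Fin (suc p)) k → Vec (Fin (suc p)) k
      translate = zipWith (λ i → d i ⊕_) variables

      -- The tuple that `a` gives on the translate equals the tuple that `b` gives on the original,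
      -- since a + (b - a) + s = b + s at each position.
      a-satisfies-translate : ∀ ss → SatisfiesConstraint b (withShifts C ss) →
        SatisfiesConstraint a (withShifts C (translate ss))
      a-satisfies-translate ss = subst (T ∘ relation)
        (sym (zipWith-fuse a⊕d⊕s≡b⊕s variables ss))
        where
        a⊕d⊕s≡b⊕s : ∀ i s → lookup a i ⊕ (d i ⊕ s) ≡ lookup b i ⊕ s
        a⊕d⊕s≡b⊕s i s = trans (sym (⊕-assoc (lookup a i) (d i) s))
          (cong (_⊕ s) (x⊕[y⊖x]≡y (lookup a i) (lookup b i)))

      b-satisfies-translates : SatisfiesConstraint b C → ∀ m →
        SatisfiesConstraint b (withShifts C (fold shifts translate m))
      b-satisfies-translates bC zero    = bC
      b-satisfies-translates bC (suc m) =
        -- One more translation passes from `b` to `a`, and `ab` leads back to `b` on the same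
        -- translate.
        ℰ⇒constraint a b ab (withShifts C (fold shifts translate (suc m)))
          (a-satisfies-translate _ (b-satisfies-translates bC m))

      fromTranslates : SatisfiesConstraint b C → SatisfiesConstraint a C
      fromTranslates bC = subst (λ ss → SatisfiesConstraint a (withShifts C ss))
        (fold-zipWith-period (λ i → d i ⊕_) (suc p) (λ i s → fold-⊕-period s (d i)) variables shifts)
        -- Only `p` rounds end at `b`; the translation number `suc p` is left at `a`, where the
        -- conclusion is wanted.
        (a-satisfies-translate _ (b-satisfies-translates bC p))

  ℰ-isEquivalence : IsEquivalence (ℰ n Γ)
  ℰ-isEquivalence = record
    { refl  = λ I → id
    ; sym   = λ {a b} → ℰ-sym a b
    ; trans = λ ab bc I → bc I ∘ ab I
    }

-- Enumeration of the constraints and the instance P_a.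

allVecs : ∀ n k → List (Vec (Fin n) k)
allVecs n zero    = List.[ [] ]
allVecs n (suc k) = cartesianProductWith _∷_ (allFin n) (allVecs n k)

∈-allVecs : ∀ {n k} (v : Vec (Fin n) k) → v ∈ allVecs n k
∈-allVecs []      = here refl
∈-allVecs (x ∷ v) = ∈-cartesianProductWith⁺ _∷_ (∈-allFin x) (∈-allVecs v)

module _ {q k : ℕ} (n : ℕ) (Γ : Language q k) where

  private
    constraint : Σ[ R ∈ Relation q k ] R ∈ Γ → Vec (Fin n) k × Vec (Fin q) k → Constraint n Γ
    constraint (R , R∈Γ) (is , ss) =
      record { relation = R ; relation∈Γ = R∈Γ ; variables = is ; shifts = ss }

  allConstraints : List (Constraint n Γ)
  allConstraints = cartesianProductWith constraint
    -- A constraint contains its proof of `R ∈ Γ`, so the enumeration has one entry for each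
    -- position in `Γ`.
    (mapWith∈ Γ (λ {R} R∈Γ → R , R∈Γ)) (cartesianProduct (allVecs n k) (allVecs q k))

  ∈-allConstraints : (C : Constraint n Γ) → C ∈ allConstraints
  ∈-allConstraints C = ∈-cartesianProductWith⁺ constraint
    (mapWith∈⁺ (λ {R} R∈Γ → R , R∈Γ) (relation , relation∈Γ , refl))
    (∈-cartesianProduct⁺ (∈-allVecs variables) (∈-allVecs shifts))
    where open Constraint C

  satisfiedBy : Assignment q n → Instance n Γ
  satisfiedBy a = filter (satisfiesConstraint? a) allConstraints

  Sat-satisfiedBy : ∀ a → Sat (satisfiedBy a) ≐ Class (ℰ n Γ) a
  Sat-satisfiedBy a =
    -- A constraint of `I` that `a` satisfies survives the filter, hence is among those that `b`
    -- satisfies.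
    (λ bP I → All.map λ {C} aC →
      All.lookup bP (∈-filter⁺ (satisfiesConstraint? a) (∈-allConstraints C) aC)) ,
    -- `a` satisfies its own filtered list, and `ab` carries this over to the other assignment.
    (λ ab → ab (satisfiedBy a) (all-filter (satisfiesConstraint? a) allConstraints))

theorem4p2 : (n q k : ℕ) → 2 ≤ q → (Γ : Language q k) →
    IsEquivalence (ℰ n Γ)
    × ((a : Assignment q n) →
    Σ[ P ∈ Instance n Γ ] (Sat P ≐ Class (ℰ n Γ) a))
theorem4p2 n (suc p) k (s≤s _) Γ =
  ℰ-isEquivalence , λ a → satisfiedBy n Γ a , Sat-satisfiedBy n Γ a
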